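{- For every (state) formula $P$ of the three-player differential game logic, a formula $P^\flat$ of (two-player) differential game logic can be computed such that $[\![P]\!]=[\![P^\flat]\!]$, i.e. both formulas are true in exactly the same states.
   Context: States and coalitions. $\mathcal V$ is the set of variables; a state is a map $\omega:\mathcal V\to\mathbb R$; $\mathcal S$ is the set of all states; $\omega_x^r$ is the state that agrees with $\omega$ except that $x$ has value $r$; $\omega[\![e]\!]$ is the value of a real-arithmetic term $e$ in $\omega$. There are three players $1,2,3$. A coalition is a nonempty subset of $\{1,2,3\}$; $\mathcal C$ is the set of all coalitions; $C_i=\{c\in\mathcal C: i\in c\}$ and $C_i^{\complement}=\mathcal C\setminus C_i$. $(\cdot)^\complement$ denotes set complement. THREE-PLAYER LOGIC. Syntax. Hybrid games $\alpha,\beta$, state formulas $P,P_1,P_2,P_3,Q$ and game formulas $\pi,\pi_1,\pi_2$ are defined simultaneously ($i\in\{1,2,3\}$, $C$ a set of coalitions, $x$ a variable, $e,\tilde e$ terms): - $\alpha,\beta ::= x:=e \mid \{x'=f(x)\,\&\,Q\}_i \mid\ ?_iQ \mid \alpha\cup_i\beta \mid \alpha;\beta \mid \alpha^{*i}$ - $P_1,P_2 ::= e\ge\tilde e \mid \neg P_1 \mid P_1\wedge P_2 \mid \forall x\,P_1 \mid \exists x\,P_1 \mid \Diamond C:\pi \mid \Box C:\pi$ - $\pi_1,\pi_2 ::= P_1^{\mathcal C} \mid \pi_1\wedge\pi_2 \mid \neg\pi_1 \mid \langle\![\alpha]\!\rangle(\pi_1) \mid \Xi(P_1,P_2,P_3)$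 Game formulas cannot stand on their own; the formulas of the logic are the state formulas. Semantics. State formulas denote subsets of $\mathcal S$ and game formulas denote subsets of $\mathcal S\times\mathcal C$. $\neg$, $\wedge$ are complement and intersection (in $\mathcal S$, resp. $\mathcal S\times\mathcal C$); $\ge,\forall,\exists$ are as in first-order real arithmetic; $[\![\Diamond C:\pi]\!]=\{\omega:\exists c\in C\ (\omega,c)\in[\![\pi]\!]\}$; $[\![\Box C:\pi]\!]=\{\omega:\forall c\in C\ (\omega,c)\in[\![\pi]\!]\}$; $[\![P^{\mathcal C}]\!]=[\![P]\!]\times\mathcal C$; $[\![\langle\![\alpha]\!\rangle(\pi)]\!]=[\![\alpha]\!]([\![\pi]\!])$; $[\![\Xi(P_1,P_2,P_3)]\!]=\{(\omega,c):\omega\in\bigcap_{i\in c}[\![P_i]\!]\}$. Winning region function $[\![\alpha]\!](\cdot):\mathcal P(\mathcal S\times\mathcal C)\to\mathcal P(\mathcal S\times\mathcal C)$: - $[\![x:=e]\!](X)=\{(\omega,c):(\omega_x^{\omega[\![e]\!]},c)\in X\}$. - $[\![\{x'=f(x)\&Q\}_i]\!](X)$ is the set of $(\omega,c)$ such that: if $i\in c$, there are $r\ge0$ and $\varphi:[0,r]\to\mathcal S$ with $\varphi(0)=\omega$, $\varphi\models x'=f(x)\wedge Q$ and $(\varphi(r),c)\in X$; if $i\notin c$, then $(\varphi(r),c)\in X$ for all $r\ge0$ and all $\varphi:[0,r]\to\mathcal S$ with $\varphi(0)=\omega$ and $\varphi\models x'=f(x)\wedge Q$. Here $\varphi\models x'=f(x)\wedge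 Q$ means that for all $0\le s\le r$: $\varphi(s)\in[\![Q]\!]$ and $\frac{d\varphi(t)(x)}{dt}(s)=\varphi(s)[\![f(x)]\!]$ (no derivative requirement if $r=0$), with variables other than $x$ constant along $\varphi$. - $[\![?_iQ]\!](X)=\{(\omega,c)\in[\![Q^{\mathcal C}]\!]\cap X: i\in c\}\cup\{(\omega,c)\in[\![Q^{\mathcal C}]\!]^\complement\cup X: i\notin c\}$. - $[\![\alpha\cup_i\beta]\!](X)=([\![\alpha]\!](X)\cap[\![\beta]\!](X))\cup\{(\omega,c)\in[\![\alpha]\!](X): i\in c\}\cup\{(\omega,c)\in[\![\beta]\!](X): i\in c\}$. - $[\![\alpha;\beta]\!](X)=[\![\alpha]\!]([\![\beta]\!](X))$. - $[\![\alpha^{*i}]\!](X)=\bigcap\{Z\subseteq\mathcal S\times C_i: (X\cup[\![\alpha]\!](Z))\cap(\mathcal S\times C_i)\subseteq Z\}\ \cup\ \bigcup\{Z\subseteq\mathcal S\times C_i^\complement: Z\subseteq X\cap[\![\alpha]\!](Z)\}$. TWO-PLAYER DIFFERENTIAL GAME LOGIC (dGL). Syntax: games $\alpha,\beta ::= x:=e \mid\ ?Q \mid x'=f(x)\,\&\,Q \mid \alpha;\beta \mid \alpha\cup\beta \mid \alpha^* \mid \alpha^d$; formulas $P,Q ::= e\ge\tilde e \mid \neg P \mid P\wedge Q \mid \forall x\,P \mid \exists x\,P \mid \langle\alpha\rangle P \mid [\alpha]P$. Semantics: $[\![P]\!]\subseteq\mathcal S$ with first-order connectives as usual, $[\![\langle\alpha\rangle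 P]\!]=\varsigma_\alpha([\![P]\!])$, $[\![[\alpha]P]\!]=\varsigma_\alpha([\![P]\!]^\complement)^\complement$, where for $X\subseteq\mathcal S$: $\varsigma_{x:=e}(X)=\{\omega:\omega_x^{\omega[\![e]\!]}\in X\}$; $\varsigma_{x'=f(x)\&Q}(X)=\{\varphi(0): \varphi(r)\in X$ for some $r\ge0$ and $\varphi:[0,r]\to\mathcal S$ with $\varphi\models x'=f(x)\wedge Q\}$; $\varsigma_{?Q}(X)=[\![Q]\!]\cap X$; $\varsigma_{\alpha\cup\beta}(X)=\varsigma_\alpha(X)\cup\varsigma_\beta(X)$; $\varsigma_{\alpha;\beta}(X)=\varsigma_\alpha(\varsigma_\beta(X))$; $\varsigma_{\alpha^d}(X)=\varsigma_\alpha(X^\complement)^\complement$; $\varsigma_{\alpha^*}(X)=\bigcap\{Z\subseteq\mathcal S: X\cup\varsigma_\alpha(Z)\subseteq Z\}$. -}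

module Defs where

open import Algebra.Structures using (IsCommutativeRing)
open import Axiom.ExcludedMiddle using (ExcludedMiddle)
open import Data.Bool.Base using (Bool; T; if_then_else_)
open import Data.Fin.Base using (Fin)
open import Data.Fin.Subset as Subset using (Subset)
open import Data.Integer.Base using (ℤ; +_; -[1+_])
open import Data.Nat.Base using (ℕ; zero; suc)
open import Data.Product.Base using (Σ-syntax; ∃-syntax; _×_; _,_)
open import Data.Rational.Base using (ℚ; ↥_; ↧ₙ_)
open import Data.Sum.Base using ([_,_]′)
open import Data.Vec.Base using (_∷_; []; lookup)
open import Level using (0ℓ) renaming (suc to lsuc)
open import Relation.Binary.Definitions using (DecidableEquality)
open import Relation.Binary.PropositionalEquality.Core using (_≡_; _≢_; refl)
open import Relation.Binary.Structures using (IsTotalOrder)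
open import Relation.Nullary.Decidable.Core using (True; does)
open import Relation.Nullary.Negation.Core using (¬_)
open import Relation.Unary using (Pred; _∈_; _⊆_; _∩_; _∪_; ∁; Satisfiable)

-- The real numbers, characterised (up to isomorphism) as a Dedekind-complete
-- ordered field.  As usual in a total-function setting, 0# ⁻¹ is unspecified.

record Reals : Set₁ where
  infixl 7 _*_
  infixl 6 _+_ _-_
  infix  8 -_ _⁻¹
  infix  4 _≤_ _<_
  field
    ℝ                 : Set
    _+_ _*_           : ℝ → ℝ → ℝ
    -_ _⁻¹            : ℝ → ℝ
    0# 1#             : ℝ
    _≤_               : ℝ → ℝ → Set
    isCommutativeRing : IsCommutativeRing _≡_ _+_ _*_ -_ 0# 1#
    0≢1               : 0# ≢ 1#
    *-inverseʳ        : ∀ x → x ≢ 0# → x * x ⁻¹ ≡ 1#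
    isTotalOrder      : IsTotalOrder _≡_ _≤_
    +-monoˡ-≤         : ∀ z {x y} → x ≤ y → x + z ≤ y + z
    *-nonNeg          : ∀ {x y} → 0# ≤ x → 0# ≤ y → 0# ≤ x * y
    supremum          : (A : Pred ℝ 0ℓ) → Satisfiable A →
                        (∃[ b ] (∀ x → x ∈ A → x ≤ b)) →
                        ∃[ s ] ((∀ x → x ∈ A → x ≤ s) ×
                                (∀ b → (∀ x → x ∈ A → x ≤ b) → s ≤ b))

  open IsTotalOrder isTotalOrder public
    using (total) renaming (refl to ≤-refl)

  _-_ : ℝ → ℝ → ℝ
  x - y = x + (- y)

  _<_ : ℝ → ℝ → Set
  x < y = x ≤ y × x ≢ y

  ∣_∣ : ℝ → ℝ
  ∣ x ∣ = [ (λ 0≤x → x) , (λ x≤0 → - x) ]′ (total 0# x)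

  fromℕ : ℕ → ℝ
  fromℕ zero    = 0#
  fromℕ (suc n) = 1# + fromℕ n

  fromℤ : ℤ → ℝ
  fromℤ (+ n)      = fromℕ n
  fromℤ (-[1+ n ]) = - fromℕ (suc n)

  fromℚ : ℚ → ℝ
  fromℚ q = fromℤ (↥ q) * fromℕ (↧ₙ q) ⁻¹

  -- The interval [0,r].  The bounds are irrelevant, so that a function on
  -- [0, r ] depends on the point only.
  record [0,_] (r : ℝ) : Set where
    constructor ⟨_,_,_⟩
    field
      point : ℝ
      .0≤   : 0# ≤ point
      .≤r   : point ≤ r
  open [0,_] public

  -- Derivative of g at s relative to [0,r] (one-sided at the end points).
  HasDerivative : ∀ {r} → ([0, r ] → ℝ) → [0, r ] → ℝ → Set
  HasDerivative g s d =
    ∀ ε → 0# < ε → ∃[ δ ] (0# < δ × (∀ t → point t ≢ point s →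
      ∣ point t - point s ∣ < δ →
      ∣ (g t - g s) * (point t - point s) ⁻¹ - d ∣ < ε))

Player : Set
Player = Fin 3

-- The proof of nonemptiness is irrelevant, so that a coalition is determined
-- by its members.
record Coalition : Set where
  constructor coalition
  field
    members   : Subset 3
    .nonempty : Subset.Nonempty members
open Coalition public

infix 4 _∈ᶜ_
_∈ᶜ_ : Player → Coalition → Set
i ∈ᶜ c = i Subset.∈ members c

CoalitionSet : Set
CoalitionSet = Coalition → Bool

data Term (V : Set) : Set where
  var     : V → Term V
  const   : ℚ → Term V
  _⊕_ _⊗_ : Term V → Term V → Term V

module ThreePlayer (V : Set) where

  infix  7 _≔_
  infixr 6 _⨟_
  infixr 5 _∪[_]_

  data Game         : Set
  data StateFormula : Set
  data GameFormula  : Set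

  data Game where
    _≔_    : V → Term V → Game
    ode    : Player → V → Term V → StateFormula → Game -- {x′ = f(x) & Q}ᵢ
    test   : Player → StateFormula → Game              -- ?ᵢ Q
    _∪[_]_ : Game → Player → Game → Game
    _⨟_    : Game → Game → Game
    _*[_]  : Game → Player → Game

  data StateFormula where
    _≥ᶠ_      : Term V → Term V → StateFormula
    ¬ᶠ_       : StateFormula → StateFormula
    _∧ᶠ_      : StateFormula → StateFormula → StateFormula
    ∀ᶠ ∃ᶠ     : V → StateFormula → StateFormula
    ◇_∶_ □_∶_ : CoalitionSet → GameFormula → StateFormula

  data GameFormula where
    _^𝒞   : StateFormula → GameFormula
    _∧ᵍ_  : GameFormula → GameFormula → GameFormula
    ¬ᵍ_   : GameFormula → GameFormula
    ⟪_⟫   : Game → GameFormula → GameFormula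
    Ξ     : StateFormula → StateFormula → StateFormula → GameFormula

module TwoPlayer (V : Set) where

  infix  7 _≔_
  infixr 6 _⨟_
  infixr 5 _⋓_

  data Game    : Set
  data Formula : Set

  data Game where
    _≔_ : V → Term V → Game
    test : Formula → Game
    ode : V → Term V → Formula → Game
    _⨟_ : Game → Game → Game
    _⋓_ : Game → Game → Game
    _⋆  : Game → Game
    _ᵈ  : Game → Game

  data Formula where
    _≥ᶠ_      : Term V → Term V → Formula
    ¬ᶠ_       : Formula → Formula
    _∧ᶠ_      : Formula → Formula → Formula
    ∀ᶠ ∃ᶠ     : V → Formula → Formula
    ⟨_⟩_ [_]_ : Game → Formula → Formula

-- Classical set-theoretic semantics over a given model of the reals.
-- Excluded middle is used in the semantics only to form the intersections and
-- unions over all regions as regions of the same universe level (`Resize`).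

module Semantics {V : Set} (_≟_ : DecidableEquality V)
                 (R : Reals) (em : ExcludedMiddle (lsuc 0ℓ)) where

  open Reals R

  Resize : Set₁ → Set
  Resize A = True (em {A})

  State : Set
  State = V → ℝ

  _[_↦_] : State → V → ℝ → State
  (ω [ x ↦ r ]) y = if does (y ≟ x) then r else ω y

  ⟦_⟧ᵗ : Term V → State → ℝ
  ⟦ var x ⟧ᵗ   ω = ω x
  ⟦ const q ⟧ᵗ ω = fromℚ q
  ⟦ e ⊕ f ⟧ᵗ   ω = ⟦ e ⟧ᵗ ω + ⟦ f ⟧ᵗ ω
  ⟦ e ⊗ f ⟧ᵗ   ω = ⟦ e ⟧ᵗ ω * ⟦ f ⟧ᵗ ω

  -- φ ⊨ x′ = e ∧ Q, for φ : [0,r] → State and Q given by its denotation.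
  record Solves {r : ℝ} (0≤r : 0# ≤ r) (φ : [0, r ] → State)
                (x : V) (e : Term V) (Q : Pred State 0ℓ) : Set where
    field
      domain     : ∀ s → φ s ∈ Q
      derivative : r ≢ 0# → ∀ s → HasDerivative (λ t → φ t x) s (⟦ e ⟧ᵗ (φ s))
      constant   : ∀ s y → y ≢ x → φ s y ≡ φ ⟨ 0# , ≤-refl , 0≤r ⟩ y

  start : ∀ {r} → 0# ≤ r → ([0, r ] → State) → State
  start 0≤r φ = φ ⟨ 0# , ≤-refl , 0≤r ⟩

  end : ∀ {r} → 0# ≤ r → ([0, r ] → State) → State
  end {r} 0≤r φ = φ ⟨ r , 0≤r , ≤-refl ⟩

  module _ where
    open ThreePlayer V

    Region : Set₁
    Region = Pred (State × Coalition) 0ℓ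

    𝒮×C_ : Player → Region
    (𝒮×C i) (ω , c) = i ∈ᶜ c

    ⟦_⟧ˢ : StateFormula → Pred State 0ℓ
    ⟦_⟧ᵍ : GameFormula → Region
    ⟦_⟧  : Game → Region → Region

    ⟦ e ≥ᶠ f ⟧ˢ  = λ ω → ⟦ f ⟧ᵗ ω ≤ ⟦ e ⟧ᵗ ω
    ⟦ ¬ᶠ P ⟧ˢ    = ∁ ⟦ P ⟧ˢ
    ⟦ P ∧ᶠ Q ⟧ˢ  = ⟦ P ⟧ˢ ∩ ⟦ Q ⟧ˢ
    ⟦ ∀ᶠ x P ⟧ˢ  = λ ω → ∀ r → ω [ x ↦ r ] ∈ ⟦ P ⟧ˢ
    ⟦ ∃ᶠ x P ⟧ˢ  = λ ω → ∃[ r ] ω [ x ↦ r ] ∈ ⟦ P ⟧ˢ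
    ⟦ ◇ C ∶ π ⟧ˢ = λ ω → ∃[ c ] (T (C c) × (ω , c) ∈ ⟦ π ⟧ᵍ)
    ⟦ □ C ∶ π ⟧ˢ = λ ω → ∀ c → T (C c) → (ω , c) ∈ ⟦ π ⟧ᵍ

    ⟦ P ^𝒞 ⟧ᵍ       = λ (ω , c) → ω ∈ ⟦ P ⟧ˢ
    ⟦ π ∧ᵍ ρ ⟧ᵍ     = ⟦ π ⟧ᵍ ∩ ⟦ ρ ⟧ᵍ
    ⟦ ¬ᵍ π ⟧ᵍ       = ∁ ⟦ π ⟧ᵍ
    ⟦ ⟪ α ⟫ π ⟧ᵍ    = ⟦ α ⟧ ⟦ π ⟧ᵍ
    ⟦ Ξ P₁ P₂ P₃ ⟧ᵍ = λ (ω , c) → ∀ i → i ∈ᶜ c →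
      ω ∈ lookup (⟦ P₁ ⟧ˢ ∷ ⟦ P₂ ⟧ˢ ∷ ⟦ P₃ ⟧ˢ ∷ []) i

    ⟦ x ≔ e ⟧ X = λ (ω , c) → (ω [ x ↦ ⟦ e ⟧ᵗ ω ] , c) ∈ X
    ⟦ ode i x e Q ⟧ X = λ (ω , c) →
      (i ∈ᶜ c →
        ∃[ r ] Σ[ 0≤r ∈ 0# ≤ r ] Σ[ φ ∈ ([0, r ] → State) ]
          (start 0≤r φ ≡ ω × Solves 0≤r φ x e ⟦ Q ⟧ˢ × (end 0≤r φ , c) ∈ X))
      ×
      (¬ (i ∈ᶜ c) →
        ∀ r (0≤r : 0# ≤ r) (φ : [0, r ] → State) →
          start 0≤r φ ≡ ω → Solves 0≤r φ x e ⟦ Q ⟧ˢ → (end 0≤r φ , c) ∈ X)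
    ⟦ test i Q ⟧ X =
      ((λ (ω , c) → ω ∈ ⟦ Q ⟧ˢ) ∩ X ∩ 𝒮×C i) ∪
      ((∁ (λ (ω , c) → ω ∈ ⟦ Q ⟧ˢ) ∪ X) ∩ ∁ (𝒮×C i))
    ⟦ α ∪[ i ] β ⟧ X =
      (⟦ α ⟧ X ∩ ⟦ β ⟧ X) ∪ ((⟦ α ⟧ X ∩ 𝒮×C i) ∪ (⟦ β ⟧ X ∩ 𝒮×C i))
    ⟦ α ⨟ β ⟧ X = ⟦ α ⟧ (⟦ β ⟧ X)
    ⟦ α *[ i ] ⟧ X =
      (λ p → Resize (∀ (Z : Region) → Z ⊆ 𝒮×C i →
                       ((X ∪ ⟦ α ⟧ Z) ∩ 𝒮×C i) ⊆ Z → p ∈ Z))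
      ∪
      (λ p → Resize (Σ[ Z ∈ Region ] (Z ⊆ ∁ (𝒮×C i) ×
                       Z ⊆ (X ∩ ⟦ α ⟧ Z) × p ∈ Z)))

  module _ where
    open TwoPlayer V

    ⟦_⟧² : Formula → Pred State 0ℓ
    ς    : Game → Pred State 0ℓ → Pred State 0ℓ

    ⟦ e ≥ᶠ f ⟧²  = λ ω → ⟦ f ⟧ᵗ ω ≤ ⟦ e ⟧ᵗ ω
    ⟦ ¬ᶠ P ⟧²    = ∁ ⟦ P ⟧²
    ⟦ P ∧ᶠ Q ⟧²  = ⟦ P ⟧² ∩ ⟦ Q ⟧²
    ⟦ ∀ᶠ x P ⟧²  = λ ω → ∀ r → ω [ x ↦ r ] ∈ ⟦ P ⟧²
    ⟦ ∃ᶠ x P ⟧²  = λ ω → ∃[ r ] ω [ x ↦ r ] ∈ ⟦ P ⟧²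
    ⟦ ⟨ α ⟩ P ⟧² = ς α ⟦ P ⟧²
    ⟦ [ α ] P ⟧² = ∁ (ς α (∁ ⟦ P ⟧²))

    ς (x ≔ e) X = λ ω → ω [ x ↦ ⟦ e ⟧ᵗ ω ] ∈ X
    ς (test Q) X = ⟦ Q ⟧² ∩ X
    ς (ode x e Q) X = λ ω →
      ∃[ r ] Σ[ 0≤r ∈ 0# ≤ r ] Σ[ φ ∈ ([0, r ] → State) ]
        (start 0≤r φ ≡ ω × Solves 0≤r φ x e ⟦ Q ⟧² × end 0≤r φ ∈ X)
    ς (α ⨟ β) X = ς α (ς β X)
    ς (α ⋓ β) X = ς α X ∪ ς β X
    ς (α ⋆) X = λ ω →
      Resize (∀ (Z : Pred State 0ℓ) → (X ∪ ς α Z) ⊆ Z → ω ∈ Z)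
    ς (α ᵈ) X = ∁ (ς α (∁ X))

{-# OPTIONS --safe #-}

-- A winning region only ever relates pairs with the same coalition, so its
-- slice at a coalition c is the winning region of a two-player game in which
-- Angel controls the decisions of the players in c and Demon those of the
-- others.  Since there are finitely many coalitions, ◇ and □ become finite
-- disjunctions and conjunctions over these slices.

module Submission where

open import Defs
open import Axiom.ExcludedMiddle using (ExcludedMiddle)
open import Axiom.DoubleNegationElimination using (DoubleNegationElimination; em⇒dne)
open import Data.Bool.Base using (T)
open import Data.Bool.Properties using (T?)
open import Data.Empty.Irrelevant using (⊥-elim)
open import Data.Fin.Base using (zero; suc)
open import Data.Fin.Subset using (Subset; Nonempty; inside; outside)
open import Data.Fin.Subset.Properties using (_∈?_; nonempty?)
open import Data.Nat.Base using (zero; suc)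
open import Data.Product.Base using (Σ-syntax; _×_; _,_; proj₁; proj₂)
open import Data.Rational.Base using (0ℚ)
open import Data.Sum.Base using (inj₁; inj₂)
open import Data.Vec.Base using (_∷_; [])
open import Function.Base using (id; _∘_)
open import Level using (0ℓ; lift; lower) renaming (suc to lsuc)
open import Relation.Binary.Definitions using (DecidableEquality)
open import Relation.Binary.PropositionalEquality.Core using (_≡_; refl)
open import Relation.Nullary.Decidable.Core
  using (Dec; yes; no; map′; toWitness; fromWitness)
open import Relation.Nullary.Negation.Core using (contradiction)
open import Relation.Unary using (Pred; _∈_; _⊆_; _≐_; _∪_; ∁)

-- Translation into two-player games, one coalition at a time.

module Translation (V : Set) where

  open ThreePlayer V
  open TwoPlayer V renaming (Game to Game²)

  ⊤ᶠ : Formula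
  ⊤ᶠ = const 0ℚ ≥ᶠ const 0ℚ

  -- The argument of `F` is irrelevant because a coalition carries its nonemptiness proof
  -- irrelevantly.
  guard : {A : Set} → Dec A → (.A → Formula) → Formula
  guard (yes a) F = F a
  guard (no _)  F = ⊤ᶠ

  ⋀ˢ : ∀ n → (Subset n → Formula) → Formula
  ⋀ˢ zero    F = F []
  ⋀ˢ (suc n) F = ⋀ˢ n (λ s → F (inside ∷ s)) ∧ᶠ ⋀ˢ n (λ s → F (outside ∷ s))

  ⋀ᶜ : CoalitionSet → (Coalition → Formula) → Formula
  ⋀ᶜ C F = ⋀ˢ 3 λ s → guard (nonempty? s) λ ne →
    guard (T? (C (coalition s ne))) λ _ → F (coalition s ne)

  control : {A : Set} → Dec A → Game² → Game²
  control (yes _) g = g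
  control (no _)  g = g ᵈ

  _♭ : StateFormula → Formula
  _♭ᵍ_ : GameFormula → Coalition → Formula
  _♭ᵃ_ : Game → Coalition → Game²

  (e ≥ᶠ f) ♭  = e ≥ᶠ f
  (¬ᶠ P) ♭    = ¬ᶠ (P ♭)
  (P ∧ᶠ Q) ♭  = (P ♭) ∧ᶠ (Q ♭)
  (∀ᶠ x P) ♭  = ∀ᶠ x (P ♭)
  (∃ᶠ x P) ♭  = ∃ᶠ x (P ♭)
  -- The finite disjunction is expressed by De Morgan.
  (◇ C ∶ π) ♭ = ¬ᶠ ⋀ᶜ C (λ c → ¬ᶠ (π ♭ᵍ c))
  (□ C ∶ π) ♭ = ⋀ᶜ C (λ c → π ♭ᵍ c)

  (P ^𝒞) ♭ᵍ c       = P ♭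
  (π ∧ᵍ ρ) ♭ᵍ c     = (π ♭ᵍ c) ∧ᶠ (ρ ♭ᵍ c)
  (¬ᵍ π) ♭ᵍ c       = ¬ᶠ (π ♭ᵍ c)
  (⟪ α ⟫ π) ♭ᵍ c    = ⟨ α ♭ᵃ c ⟩ (π ♭ᵍ c)
  (Ξ P₁ P₂ P₃) ♭ᵍ c =
    guard (zero ∈? members c) (λ _ → P₁ ♭) ∧ᶠ
    (guard (suc zero ∈? members c) (λ _ → P₂ ♭) ∧ᶠ
     guard (suc (suc zero) ∈? members c) (λ _ → P₃ ♭))

  (x ≔ e) ♭ᵃ c       = x ≔ e
  (ode i x e Q) ♭ᵃ c = control (i ∈? members c) (ode x e (Q ♭))
  (test i Q) ♭ᵃ c    = control (i ∈? members c) (test (Q ♭))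
  (α ∪[ i ] β) ♭ᵃ c  =
    let d = i ∈? members c in
    -- The inner duals undo the outer one on the subgames, so only the choice itself changes hands.
    -- The loop is treated likewise.
    control d (control d (α ♭ᵃ c) ⋓ control d (β ♭ᵃ c))
  (α ⨟ β) ♭ᵃ c       = (α ♭ᵃ c) ⨟ (β ♭ᵃ c)
  (α *[ i ]) ♭ᵃ c    =
    let d = i ∈? members c in control d (control d (α ♭ᵃ c) ⋆)

module Correctness {V : Set} (_≟_ : DecidableEquality V)
                   (R : Reals) (em : ExcludedMiddle (lsuc 0ℓ)) where

  open Reals R using (0#; _≤_; [0,_]; ≤-refl)
  open Semantics _≟_ R em
  open ThreePlayer V
  open TwoPlayer V renaming (Game to Game²)
  open Translation V

  dne : DoubleNegationElimination 0ℓ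
  dne = em⇒dne (map′ lower lift em)

  -- Monotonicity and iteration in two-player games.

  Solves-mono : ∀ {r} {0≤r : 0# ≤ r} {φ : [0, r ] → State} {x e} {P Q : Pred State 0ℓ} →
                P ⊆ Q → Solves 0≤r φ x e P → Solves 0≤r φ x e Q
  Solves-mono P⊆Q sol = record
    { domain     = λ s → P⊆Q (domain s)
    ; derivative = derivative
    ; constant   = constant
    } where open Solves sol

  -- A dual complements twice, which preserves inclusions; for a loop, every set closed for `Y` is
  -- closed for `X`.
  ς-mono : ∀ g {X Y : Pred State 0ℓ} → X ⊆ Y → ς g X ⊆ ς g Y
  ς-mono (x ≔ e)     X⊆Y ω∈X = X⊆Y ω∈X
  ς-mono (test Q)    X⊆Y (ω∈Q , ω∈X) = ω∈Q , X⊆Y ω∈X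
  ς-mono (ode x e Q) X⊆Y (r , 0≤r , φ , st , sol , end∈X) =
    r , 0≤r , φ , st , sol , X⊆Y end∈X
  ς-mono (g ⨟ h) X⊆Y = ς-mono g (ς-mono h X⊆Y)
  ς-mono (g ⋓ h) X⊆Y (inj₁ win) = inj₁ (ς-mono g X⊆Y win)
  ς-mono (g ⋓ h) X⊆Y (inj₂ win) = inj₂ (ς-mono h X⊆Y win)
  ς-mono (g ⋆)   X⊆Y win = fromWitness λ Z pre → toWitness win Z λ where
    (inj₁ ω∈X) → pre (inj₁ (X⊆Y ω∈X))
    (inj₂ ω∈Z) → pre (inj₂ ω∈Z)
  ς-mono (g ᵈ)   X⊆Y lose win = lose (ς-mono g (λ ω∉Y ω∈X → ω∉Y (X⊆Y ω∈X)) win)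

  -- Knaster-Tarski: the intersection lies in each closed `Z`, so by monotonicity one more round
  -- from it stays in `Z`.
  ς-⋆-prefixpoint : ∀ g (X : Pred State 0ℓ) → (X ∪ ς g (ς (g ⋆) X)) ⊆ ς (g ⋆) X
  ς-⋆-prefixpoint g X (inj₁ ω∈X) = fromWitness λ Z pre → pre (inj₁ ω∈X)
  ς-⋆-prefixpoint g X (inj₂ win) = fromWitness λ Z pre →
    pre (inj₂ (ς-mono g (λ ω∈μ → toWitness ω∈μ Z pre) win))

  -- Finite conjunctions over coalitions.

  guard⁺ : ∀ {A : Set} (d : Dec A) (F : .A → Formula) {ω} →
           ((a : A) → ω ∈ ⟦ F a ⟧²) → ω ∈ ⟦ guard d F ⟧²
  guard⁺ (yes a) F h = h a
  guard⁺ (no _)  F h = ≤-refl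

  guard⁻ : ∀ {A : Set} (d : Dec A) (F : .A → Formula) {ω} →
           ω ∈ ⟦ guard d F ⟧² → .(a : A) → ω ∈ ⟦ F a ⟧²
  guard⁻ (yes _) F h a = h
  guard⁻ (no ¬a) F h a = ⊥-elim (¬a a)

  ⋀ˢ⁺ : ∀ n F {ω} → (∀ s → ω ∈ ⟦ F s ⟧²) → ω ∈ ⟦ ⋀ˢ n F ⟧²
  ⋀ˢ⁺ zero    F h = h []
  ⋀ˢ⁺ (suc n) F h =
    ⋀ˢ⁺ n (F ∘ (inside ∷_)) (h ∘ (inside ∷_)) ,
    ⋀ˢ⁺ n (F ∘ (outside ∷_)) (h ∘ (outside ∷_))

  ⋀ˢ⁻ : ∀ n F {ω} → ω ∈ ⟦ ⋀ˢ n F ⟧² → ∀ s → ω ∈ ⟦ F s ⟧²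
  ⋀ˢ⁻ zero    F h       []            = h
  ⋀ˢ⁻ (suc n) F (h , _) (inside ∷ s)  = ⋀ˢ⁻ n (F ∘ (inside ∷_)) h s
  ⋀ˢ⁻ (suc n) F (_ , h) (outside ∷ s) = ⋀ˢ⁻ n (F ∘ (outside ∷_)) h s

  module _ (C : CoalitionSet) (F : Coalition → Formula) where

    member : ∀ s → .(Nonempty s) → Formula
    member s ne = guard (T? (C (coalition s ne))) λ _ → F (coalition s ne)

    conjunct : Subset 3 → Formula
    conjunct s = guard (nonempty? s) (member s)

    ⋀ᶜ⁺ : ∀ {ω} → (∀ c → T (C c) → ω ∈ ⟦ F c ⟧²) → ω ∈ ⟦ ⋀ᶜ C F ⟧²
    ⋀ᶜ⁺ h = ⋀ˢ⁺ 3 conjunct λ s → guard⁺ (nonempty? s) (member s) λ ne →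
      guard⁺ (T? (C (coalition s ne))) (λ _ → F (coalition s ne)) (h (coalition s ne))

    ⋀ᶜ⁻ : ∀ {ω} → ω ∈ ⟦ ⋀ᶜ C F ⟧² → ∀ c → T (C c) → ω ∈ ⟦ F c ⟧²
    ⋀ᶜ⁻ h c@(coalition s ne) c∈C = guard⁻ (T? (C c)) (λ _ → F c)
      (guard⁻ (nonempty? s) (member s) (⋀ˢ⁻ 3 conjunct h s) ne) c∈C

  -- Slices of winning regions, by game construct.

  slice : Coalition → Region → Pred State 0ℓ
  slice c X ω = (ω , c) ∈ X

  -- Membership of `i` in `c` selects the angelic or the demonic clause. Taking `d` as an argument
  -- lets a match on it reduce `control d`; the next three lemmas do the same.
  ode-slice : ∀ {i c} (d : Dec (i ∈ᶜ c)) x e Q Q² X → ⟦ Q ⟧ˢ ≐ ⟦ Q² ⟧² →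
              slice c (⟦ ode i x e Q ⟧ X) ≐ ς (control d (ode x e Q²)) (slice c X)
  ode-slice {i} {c} (yes i∈c) x e Q Q² X (Q⊆Q² , Q²⊆Q) = to , from
    where
    to : slice c (⟦ ode i x e Q ⟧ X) ⊆ ς (ode x e Q²) (slice c X)
    to (angel , _) with angel i∈c
    ... | r , 0≤r , φ , st , sol , end∈X =
      r , 0≤r , φ , st , Solves-mono Q⊆Q² sol , end∈X
    from : ς (ode x e Q²) (slice c X) ⊆ slice c (⟦ ode i x e Q ⟧ X)
    from (r , 0≤r , φ , st , sol , end∈X) =
      (λ _ → r , 0≤r , φ , st , Solves-mono Q²⊆Q sol , end∈X) ,
      λ i∉c → contradiction i∈c i∉c
  ode-slice {i} {c} (no i∉c) x e Q Q² X (Q⊆Q² , Q²⊆Q) = to , from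
    where
    to : slice c (⟦ ode i x e Q ⟧ X) ⊆ ς (ode x e Q² ᵈ) (slice c X)
    to (_ , demon) (r , 0≤r , φ , st , sol , end∉X) =
      end∉X (demon i∉c r 0≤r φ st (Solves-mono Q²⊆Q sol))
    from : ς (ode x e Q² ᵈ) (slice c X) ⊆ slice c (⟦ ode i x e Q ⟧ X)
    from h =
      (λ i∈c → contradiction i∈c i∉c) ,
      λ _ r 0≤r φ st sol → dne λ end∉X →
        h (r , 0≤r , φ , st , Solves-mono Q⊆Q² sol , end∉X)

  test-slice : ∀ {i c} (d : Dec (i ∈ᶜ c)) Q Q² X → ⟦ Q ⟧ˢ ≐ ⟦ Q² ⟧² →
               slice c (⟦ test i Q ⟧ X) ≐ ς (control d (test Q²)) (slice c X)
  test-slice (yes i∈c) Q Q² X (Q⊆Q² , Q²⊆Q) =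
    (λ { (inj₁ (q , x , _)) → Q⊆Q² q , x
       ; (inj₂ (_ , i∉c))   → contradiction i∈c i∉c }) ,
    λ (q , x) → inj₁ (Q²⊆Q q , x , i∈c)
  test-slice (no i∉c) Q Q² X (Q⊆Q² , Q²⊆Q) =
    (λ { (inj₁ (_ , _ , i∈c))  _        → i∉c i∈c
       ; (inj₂ (inj₁ ¬q , _)) (q , _)  → ¬q (Q²⊆Q q)
       ; (inj₂ (inj₂ x , _))  (_ , ¬x) → ¬x x }) ,
    -- `k` refutes both disjuncts. Refuting the failure of `Q` means that `Q` may be assumed, and
    -- then `h` yields `X`.
    λ h → dne λ k →
      k (inj₂ (inj₁ (λ q → k (inj₂ (inj₂ (dne λ ¬x → h (Q⊆Q² q , ¬x)) , i∉c))) , i∉c))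

  choice-slice : ∀ {i c} (d : Dec (i ∈ᶜ c)) α β g h X →
                 slice c (⟦ α ⟧ X) ≐ ς g (slice c X) →
                 slice c (⟦ β ⟧ X) ≐ ς h (slice c X) →
                 slice c (⟦ α ∪[ i ] β ⟧ X) ≐
                 ς (control d (control d g ⋓ control d h)) (slice c X)
  choice-slice (yes i∈c) α β g h X (α⊆g , g⊆α) (β⊆h , h⊆β) =
    (λ { (inj₁ (a , _))        → inj₁ (α⊆g a)
       ; (inj₂ (inj₁ (a , _))) → inj₁ (α⊆g a)
       ; (inj₂ (inj₂ (b , _))) → inj₂ (β⊆h b) }) ,
    λ { (inj₁ a) → inj₂ (inj₁ (g⊆α a , i∈c))
      ; (inj₂ b) → inj₂ (inj₂ (h⊆β b , i∈c)) }
  choice-slice (no i∉c) α β g h X (α⊆g , g⊆α) (β⊆h , h⊆β) =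
    -- By De Morgan the dualised choice wins iff both subgames win; the double complement of the
    -- target is added or removed by `ς-mono`.
    (λ { (inj₁ (a , _)) (inj₁ ¬a) → ¬a (ς-mono g (λ x ¬x → ¬x x) (α⊆g a))
       ; (inj₁ (_ , b)) (inj₂ ¬b) → ¬b (ς-mono h (λ x ¬x → ¬x x) (β⊆h b))
       ; (inj₂ (inj₁ (_ , i∈c))) _ → i∉c i∈c
       ; (inj₂ (inj₂ (_ , i∈c))) _ → i∉c i∈c }) ,
    λ k → inj₁ (g⊆α (ς-mono g dne (dne (k ∘ inj₁))) ,
                h⊆β (ς-mono h dne (dne (k ∘ inj₂))))

  -- The hypothesis covers all `Z` because the fixpoints range over arbitrary regions. A demonic
  -- loop is a greatest fixpoint, the complement of a least fixpoint of the dual game.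
  loop-slice : ∀ {i c} (d : Dec (i ∈ᶜ c)) α g X →
               (∀ Z → slice c (⟦ α ⟧ Z) ≐ ς g (slice c Z)) →
               slice c (⟦ α *[ i ] ⟧ X) ≐ ς (control d (control d g ⋆)) (slice c X)
  loop-slice {i} {c} (yes i∈c) α g X α≐g = to , from
    where
    to : slice c (⟦ α *[ i ] ⟧ X) ⊆ ς (g ⋆) (slice c X)
    -- Z is extended by everything at the other coalitions, so that only the
    -- slice at c has to be shown closed.
    to (inj₁ lfp) = fromWitness λ Z pre →
      let
        Z↑ : Region
        Z↑ = λ (ω , c′) → i ∈ᶜ c′ × (c′ ≡ c → ω ∈ Z)

        pre↑ : ∀ {p} → (p ∈ X ∪ ⟦ α ⟧ Z↑) × p ∈ 𝒮×C i → p ∈ Z↑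
        pre↑ = λ where
          (inj₁ x , i∈c′) → i∈c′ , λ { refl → pre (inj₁ x) }
          (inj₂ a , i∈c′) → i∈c′ , λ { refl →
            pre (inj₂ (ς-mono g (λ (_ , z) → z refl) (proj₁ (α≐g Z↑) a))) }
      in proj₂ (toWitness lfp Z↑ proj₁ pre↑) refl
    to (inj₂ gfp) with toWitness gfp
    ... | Z , Z⊆∁C , _ , p∈Z = contradiction i∈c (Z⊆∁C p∈Z)

    from : ς (g ⋆) (slice c X) ⊆ slice c (⟦ α *[ i ] ⟧ X)
    from lfp = inj₁ (fromWitness λ Z Z⊆C pre → toWitness lfp (slice c Z) λ where
      (inj₁ x) → pre (inj₁ x , i∈c)
      (inj₂ a) → pre (inj₂ (proj₂ (α≐g Z) a) , i∈c))
  loop-slice {i} {c} (no i∉c) α g X α≐g = to , from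
    where
    μ : Pred State 0ℓ
    μ = ς (g ᵈ ⋆) (∁ (slice c X))

    to : slice c (⟦ α *[ i ] ⟧ X) ⊆ ∁ μ
    -- 𝒮×C i is a prefixpoint without pairs at c, so the least fixpoint is void.
    to (inj₁ lfp) _ = i∉c (toWitness lfp (𝒮×C i) id proj₂)
    to (inj₂ gfp) ω∈μ with toWitness gfp
    -- The complement of a postfixpoint is closed under the dual game, hence contains `μ`.
    ... | Z , _ , Z⊆ , ω∈Z = toWitness ω∈μ (∁ (slice c Z)) (λ where
      (inj₁ ¬x) z → ¬x (proj₁ (Z⊆ z))
      (inj₂ ¬a) z → ¬a (ς-mono g (λ z′ ¬z′ → ¬z′ z′) (proj₁ (α≐g Z) (proj₂ (Z⊆ z))))) ω∈Z

    -- The greatest fixpoint placed at `c` alone, which keeps it outside `𝒮×C i`; it witnesses the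
    -- union in the loop semantics.
    ν : Region
    ν (ω , c′) = c′ ≡ c × ω ∈ ∁ μ

    ν⊆X : ∀ {ω} → ω ∈ ∁ μ → (ω , c) ∈ X
    ν⊆X ω∉μ = dne λ ¬x → ω∉μ (ς-⋆-prefixpoint (g ᵈ) (∁ (slice c X)) (inj₁ ¬x))

    -- Otherwise the dual of `g` wins into `μ` from `ω`, and closedness of `μ` puts `ω` into `μ`.
    ν⊆αν : ∀ {ω} → ω ∈ ∁ μ → (ω , c) ∈ ⟦ α ⟧ ν
    ν⊆αν ω∉μ = proj₂ (α≐g ν) (ς-mono g (λ ω′∉μ → refl , ω′∉μ)
      (dne λ ¬a → ω∉μ (ς-⋆-prefixpoint (g ᵈ) (∁ (slice c X)) (inj₂ ¬a))))

    from : ∁ μ ⊆ slice c (⟦ α *[ i ] ⟧ X)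
    from ω∉μ = inj₂ (fromWitness
      (ν , (λ { (refl , _) → i∉c }) ,
       (λ { (refl , ω′∉μ) → ν⊆X ω′∉μ , ν⊆αν ω′∉μ }) ,
       (refl , ω∉μ)))

  -- Correctness by simultaneous structural induction.

  ♭-correct  : ∀ P → ⟦ P ⟧ˢ ≐ ⟦ P ♭ ⟧²
  ♭ᵍ-correct : ∀ π c → slice c ⟦ π ⟧ᵍ ≐ ⟦ π ♭ᵍ c ⟧²
  -- Arbitrary `X` makes the induction hypothesis applicable to the regions arising in compositions
  -- and loops.
  ♭ᵃ-correct : ∀ α c X → slice c (⟦ α ⟧ X) ≐ ς (α ♭ᵃ c) (slice c X)

  ♭-correct (e ≥ᶠ f) = id , id
  ♭-correct (¬ᶠ P) = let P⊆P♭ , P♭⊆P = ♭-correct P in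
    (λ ¬p p → ¬p (P♭⊆P p)) , (λ ¬p p → ¬p (P⊆P♭ p))
  ♭-correct (P ∧ᶠ Q) =
    let P⊆P♭ , P♭⊆P = ♭-correct P
        Q⊆Q♭ , Q♭⊆Q = ♭-correct Q in
    (λ (p , q) → P⊆P♭ p , Q⊆Q♭ q) , (λ (p , q) → P♭⊆P p , Q♭⊆Q q)
  ♭-correct (∀ᶠ x P) = let P⊆P♭ , P♭⊆P = ♭-correct P in
    (λ p r → P⊆P♭ (p r)) , (λ p r → P♭⊆P (p r))
  ♭-correct (∃ᶠ x P) = let P⊆P♭ , P♭⊆P = ♭-correct P in
    (λ (r , p) → r , P⊆P♭ p) , (λ (r , p) → r , P♭⊆P p)
  ♭-correct (◇ C ∶ π) =
    (λ (c , c∈C , p) h →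
      ⋀ᶜ⁻ C (λ c → ¬ᶠ (π ♭ᵍ c)) h c c∈C (proj₁ (♭ᵍ-correct π c) p)) ,
    -- Were there no winning coalition in `C`, every negated conjunct would hold, against `h`.
    λ h → dne λ k → h (⋀ᶜ⁺ C (λ c → ¬ᶠ (π ♭ᵍ c)) λ c c∈C p →
      k (c , c∈C , proj₂ (♭ᵍ-correct π c) p))
  ♭-correct (□ C ∶ π) =
    (λ h → ⋀ᶜ⁺ C (π ♭ᵍ_) λ c c∈C → proj₁ (♭ᵍ-correct π c) (h c c∈C)) ,
    λ h c c∈C → proj₂ (♭ᵍ-correct π c) (⋀ᶜ⁻ C (π ♭ᵍ_) h c c∈C)

  ♭ᵍ-correct (P ^𝒞) c = ♭-correct P
  ♭ᵍ-correct (π ∧ᵍ ρ) c =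
    let π⊆π♭ , π♭⊆π = ♭ᵍ-correct π c
        ρ⊆ρ♭ , ρ♭⊆ρ = ♭ᵍ-correct ρ c in
    (λ (p , q) → π⊆π♭ p , ρ⊆ρ♭ q) , (λ (p , q) → π♭⊆π p , ρ♭⊆ρ q)
  ♭ᵍ-correct (¬ᵍ π) c = let π⊆π♭ , π♭⊆π = ♭ᵍ-correct π c in
    (λ ¬p p → ¬p (π♭⊆π p)) , (λ ¬p p → ¬p (π⊆π♭ p))
  ♭ᵍ-correct (⟪ α ⟫ π) c =
    let α⊆α♭ , α♭⊆α = ♭ᵃ-correct α c ⟦ π ⟧ᵍ
        π⊆π♭ , π♭⊆π = ♭ᵍ-correct π c in
    (λ win → ς-mono (α ♭ᵃ c) π⊆π♭ (α⊆α♭ win)) ,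
    (λ win → α♭⊆α (ς-mono (α ♭ᵃ c) π♭⊆π win))
  ♭ᵍ-correct (Ξ P₁ P₂ P₃) c =
    (λ h →
      guard⁺ (zero ∈? members c) (λ _ → P₁ ♭) (λ m → proj₁ (♭-correct P₁) (h zero m)) ,
      guard⁺ (suc zero ∈? members c) (λ _ → P₂ ♭) (λ m → proj₁ (♭-correct P₂) (h (suc zero) m)) ,
      guard⁺ (suc (suc zero) ∈? members c) (λ _ → P₃ ♭)
        (λ m → proj₁ (♭-correct P₃) (h (suc (suc zero)) m))) ,
    λ { (h₁ , h₂ , h₃) → λ where
      zero             m → proj₂ (♭-correct P₁) (guard⁻ (zero ∈? members c) (λ _ → P₁ ♭) h₁ m)
      (suc zero)       m → proj₂ (♭-correct P₂) (guard⁻ (suc zero ∈? members c) (λ _ → P₂ ♭) h₂ m)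
      (suc (suc zero)) m → proj₂ (♭-correct P₃) (guard⁻ (suc (suc zero) ∈? members c) (λ _ → P₃ ♭) h₃ m) }

  ♭ᵃ-correct (x ≔ e)       c X = id , id
  ♭ᵃ-correct (ode i x e Q) c X =
    ode-slice (i ∈? members c) x e Q (Q ♭) X (♭-correct Q)
  ♭ᵃ-correct (test i Q)    c X =
    test-slice (i ∈? members c) Q (Q ♭) X (♭-correct Q)
  ♭ᵃ-correct (α ∪[ i ] β)  c X =
    choice-slice (i ∈? members c) α β (α ♭ᵃ c) (β ♭ᵃ c) X (♭ᵃ-correct α c X) (♭ᵃ-correct β c X)
  ♭ᵃ-correct (α ⨟ β)       c X =
    let α⊆α♭ , α♭⊆α = ♭ᵃ-correct α c (⟦ β ⟧ X)
        β⊆β♭ , β♭⊆β = ♭ᵃ-correct β c X in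
    -- First `α` is translated with the slice of `⟦ β ⟧ X` as target, then monotonicity exchanges
    -- the target.
    (λ win → ς-mono (α ♭ᵃ c) β⊆β♭ (α⊆α♭ win)) ,
    (λ win → α♭⊆α (ς-mono (α ♭ᵃ c) β♭⊆β win))
  ♭ᵃ-correct (α *[ i ])    c X =
    loop-slice (i ∈? members c) α (α ♭ᵃ c) X (♭ᵃ-correct α c)

lemma8 : (V : Set) (_≟_ : DecidableEquality V) →
    Σ[ _♭ ∈ (ThreePlayer.StateFormula V → TwoPlayer.Formula V) ]
    ((R : Reals) (em : ExcludedMiddle (lsuc 0ℓ)) →
    let open Semantics _≟_ R em in
    (P : ThreePlayer.StateFormula V) → ⟦ P ⟧ˢ ≐ ⟦ P ♭ ⟧²)
-- The translation is fixed before `R` and `em` are given, so it is purely syntactic.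
lemma8 V _≟_ = Translation._♭ V , λ R em → Correctness.♭-correct _≟_ R em
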